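{- For every $m\ge 2$, every tree $m$-pole $T_m$ is non-separable and irreducible.
   Context: An $m$-pole ($m\ge 1$), or multipole, $M=(V,E,\mathcal{E})$ consists of a finite set $V=V(M)$ of vertices, a finite collection $E$ of edges (unordered pairs of vertices; parallel edges and loops may occur), and a set $\mathcal{E}=\{\epsilon_1,\dots,\epsilon_m\}$ of $m$ semiedges. Each semiedge is either incident to exactly one vertex, or is paired with another semiedge to form a free (isolated) edge, which has no vertices. All multipoles are cubic: for each vertex, the number of edges (loops counted twice) plus semiedges incident to it is $3$. A multipole may be disconnected, and $V$ may be empty. Each free edge counts as one connected component. A Tait coloring of $M$ is a map $\phi:E\cup\mathcal{E}\to\{1,2,3\}$ such that the three edges/semiedges incident with any vertex receive distinct colors (so a multipole with a loop has none) and the two semiedges of any free edge receive the same color. $\mathrm{Col}(M)$ is the set of states of $M$, i.e. of tuples $(\phi(\epsilon_1),\dots,\phi(\epsilon_m))$ with $\phi$ a Tait coloring of $M$. A tree multipole is a connected multipole whose underlying graph (obtained by deleting all semiedges) is a tree; a single free edge is also regarded as a tree multipole (the tree $2$-pole). An $m$-pole $M$ is reducible if there is an $m$-pole $N$ (with its semiedges numbered) such that $|V(N)|<|V(M)|$ and $\emptyset\ne\mathrm{Col}(N)\subseteq\mathrm{Col}(M)$; otherwise $M$ is irreducible. An $m$-pole $M$ with $c$ connected components is separable if there is an $m$-pole $N$ (with its semiedges numbered) with at least $c+1$ components, $|V(N)|=|V(M)|$ and $\emptyset\ne\mathrm{Col}(N)\subseteq\mathrm{Col}(M)$; otherwise it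 is non-separable. -}

module Defs where

open import Data.Fin using (Fin; _≟_)
open import Data.Fin.Patterns using (0F; 1F)
open import Data.List using (List; []; _∷_; length; filter; allFin)
open import Data.List.Relation.Unary.Unique.Propositional using (Unique)
open import Data.Nat using (ℕ; _+_; _<_)
open import Data.Product using (∃; _×_; _,_)
open import Data.Sum using (_⊎_; inj₁; inj₂)
open import Data.Sum.Properties using (≡-dec)
open import Data.Vec using (Vec; tabulate)
open import Function using (_∘_)
open import Function.Bundles using (Bijection)
open import Level using (0ℓ)
open import Relation.Binary using (Rel; Setoid)
open import Relation.Binary.Construct.Closure.Equivalence as EqC using ()
open import Relation.Binary.PropositionalEquality using (_≡_; _≢_; setoid)
open import Relation.Nullary using (¬_)
open import Relation.Unary using (Pred; Decidable; Satisfiable; _⊆_)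

count : ∀ {n} {P : Pred (Fin n) 0ℓ} → Decidable P → ℕ
count P? = length (filter P? (allFin _))

-- Finite undirected multigraphs, loops and parallel edges allowed.  The two
-- ends of an edge are listed in some order, to which no later notion is
-- sensitive.
record Graph : Set where
  field
    #V  : ℕ
    #E  : ℕ
    end : Fin #E → Fin 2 → Fin #V

module _ (G : Graph) where
  open Graph G

  Joins : Fin #E → Fin #V → Fin #V → Set
  Joins e u v = (end e 0F ≡ u × end e 1F ≡ v) ⊎ (end e 0F ≡ v × end e 1F ≡ u)

  data Walk : Fin #V → Fin #V → Set where
    stop : ∀ {u} → Walk u u
    step : ∀ {u v w} (e : Fin #E) → Joins e u v → Walk v w → Walk u w

  walkEdges : ∀ {u v} → Walk u v → List (Fin #E)
  walkEdges stop         = []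
  walkEdges (step e _ p) = e ∷ walkEdges p

  -- All vertices of the walk except its last one.
  walkSources : ∀ {u v} → Walk u v → List (Fin #V)
  walkSources stop                 = []
  walkSources (step {u = u} _ _ p) = u ∷ walkSources p

  -- Loops are cycles of length 1, pairs of parallel edges give cycles of
  -- length 2; distinctness of the edges excludes going back and forth along
  -- a single edge.
  record Cycle : Set where
    field
      base             : Fin #V
      walk             : Walk base base
      nonempty         : 0 < length (walkEdges walk)
      distinctEdges    : Unique (walkEdges walk)
      distinctVertices : Unique (walkSources walk)

  IsTree : Set
  IsTree = 0 < #V × (∀ u v → Walk u v) × ¬ Cycle

-- Cubic m-poles with semiedges numbered by Fin m.  `attach i` is either the
-- vertex incident to the i-th semiedge, or the semiedge with which it forms a
-- free edge.
record Multipole (m : ℕ) : Set where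
  field
    graph : Graph

  open Graph graph public

  field
    attach      : Fin m → Fin #V ⊎ Fin m
    mate-sym    : ∀ {i j} → attach i ≡ inj₂ j → attach j ≡ inj₂ i
    mate-irrefl : ∀ {i} → attach i ≢ inj₂ i

  -- A loop at v contributes to both of the first two terms.
  degree : Fin #V → ℕ
  degree v = count (λ e → end e 0F ≟ v)
           + count (λ e → end e 1F ≟ v)
           + count (λ i → ≡-dec _≟_ _≟_ (attach i) (inj₁ v))

  field
    cubic : ∀ v → degree v ≡ 3

Colour : Set
Colour = Fin 3

module _ {m : ℕ} (M : Multipole m) where
  open Multipole M

  -- Every edge has a vertex and every free edge has a semiedge, so connected
  -- components can be counted on vertices and semiedges alone.
  Node : Set
  Node = Fin #V ⊎ Fin m

  data Adjacent : Rel Node 0ℓ where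
    edge     : ∀ e → Adjacent (inj₁ (end e 0F)) (inj₁ (end e 1F))
    semiedge : ∀ i → Adjacent (inj₂ i) (attach i)

  -- Nodes, with lying in the same connected component as equality.
  connectivity : Setoid 0ℓ 0ℓ
  connectivity = EqC.setoid Adjacent

  HasComponents : ℕ → Set
  HasComponents c = Bijection connectivity (setoid (Fin c))

  -- The edge ends and semiedges, i.e. whatever can be incident to a vertex;
  -- a loop has two ends at its vertex.
  Dart : Set
  Dart = (Fin #E × Fin 2) ⊎ Fin m

  Incident : Dart → Fin #V → Set
  Incident (inj₁ (e , s)) v = end e s ≡ v
  Incident (inj₂ i)       v = attach i ≡ inj₁ v

  carrier : Dart → Fin #E ⊎ Fin m
  carrier (inj₁ (e , _)) = inj₁ e
  carrier (inj₂ i)       = inj₂ i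

  record IsTaitColouring (φ : Fin #E ⊎ Fin m → Colour) : Set where
    field
      proper : ∀ {v d d′} → Incident d v → Incident d′ v → d ≢ d′ →
               φ (carrier d) ≢ φ (carrier d′)
      free   : ∀ {i j} → attach i ≡ inj₂ j → φ (inj₂ i) ≡ φ (inj₂ j)

  Col : Pred (Vec Colour m) 0ℓ
  Col s = ∃ λ φ → IsTaitColouring φ × tabulate (φ ∘ inj₂) ≡ s

  -- Without vertices every semiedge belongs to a free edge, so a vertexless
  -- 2-pole is a single free edge.
  IsFreeEdge : Set
  IsFreeEdge = m ≡ 2 × #V ≡ 0

  IsTreeMultipole : Set
  IsTreeMultipole = HasComponents 1 × (IsTree graph ⊎ IsFreeEdge)

module _ {m : ℕ} (M : Multipole m) where
  open Multipole using (#V)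

  Reducible : Set
  Reducible = ∃ λ (N : Multipole m) →
    #V N < #V M × Satisfiable (Col N) × Col N ⊆ Col M

  Irreducible : Set
  Irreducible = ¬ Reducible

  Separable : Set
  Separable = ∃ λ (N : Multipole m) → ∃ λ c → ∃ λ c′ →
    HasComponents M c × HasComponents N c′ × c < c′ ×
    #V N ≡ #V M × Satisfiable (Col N) × Col N ⊆ Col M

  NonSeparable : Set
  NonSeparable = ¬ Separable

{-# OPTIONS --safe #-}
module Submission where

-- Let N have ∅ ≠ Col N ⊆ Col T.  Identify the colours with the nonzero elements
-- of 𝔽₄, with generator ω.  Given a colouring of N and a union of components of
-- N, multiply the colours on that union by ωᵏ (k = 0, 1, 2) and let φₖ be a
-- colouring of T with the resulting state.  The 𝔽₄-flow φ₀ + ω φ₁ + ω² φ₂ on T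
-- vanishes on the semiedges, hence everywhere as T is acyclic.  Three nonzero
-- elements of 𝔽₄ with sum zero are distinct, so each edge of T is either fixed
-- (φ₀ = φ₁ = φ₂) or turning (φₖ = ωᵏ φ₀); since every φₖ is proper, a fixed and a
-- turning edge cannot meet, and T being connected all its semiedges are of the
-- same kind.  Hence all semiedges of N lie in one component.  That component has
-- at least m ∸ 2 vertices, and T has at most m ∸ 2.

open import Defs
open import Algebra.Bundles using (CommutativeMonoid; CommutativeRing)
import Data.Bool as Bool
open import Data.Bool using (Bool; true; false; if_then_else_; _xor_; not)
open import Data.Bool.Properties using (xor-∧-commutativeRing; xor-same; xor-identityʳ)
open import Data.Empty using (⊥)
open import Data.Fin using (Fin; zero; suc; _≟_; fromℕ<)
open import Data.Fin.Patterns using (0F; 1F; 2F)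
open import Data.Fin.Properties using (suc-injective; all?; injective⇒≤; ¬Fin0)
open import Data.List using (List; []; _∷_; length; filter; allFin; foldr; map; _++_; tabulate)
open import Data.List.Membership.Propositional using (_∈_; _∉_)
open import Data.List.Membership.Propositional.Properties using (∈-allFin; ∈-filter⁺; ∈-filter⁻; ∈-map⁻)
open import Data.List.Properties using (length-++; length-map; length-tabulate)
open import Data.List.Relation.Unary.All as All using (All; []; _∷_)
import Data.List.Relation.Unary.All.Properties as All
open import Data.List.Relation.Unary.AllPairs using ([]; _∷_)
open import Data.List.Relation.Unary.Any using (here; there)
open import Data.List.Relation.Unary.Unique.Propositional using (Unique)
import Data.List.Relation.Unary.Unique.Propositional.Properties as Unique
open import Data.Nat using (ℕ; suc; _+_; _*_; _≤_; z≤n; s≤s)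
open import Data.Nat.GeneralisedArithmetic using (iterate)
open import Data.Nat.Properties using
  ( *-distribˡ-+; *-identityʳ; *-monoʳ-≤; +-0-commutativeMonoid; +-assoc; +-cancelʳ-≤; +-cancelˡ-≤; +-comm
  ; +-identityʳ; +-mono-≤; +-monoʳ-≤; +-monoˡ-<; +-monoˡ-≤; +-suc; 1+n≰n; <-irrefl
  ; <-≤-trans; m≤m+n; m≤n+m; n≤0⇒n≡0; ≤-refl; ≤-reflexive; ≤-trans; module ≤-Reasoning )
open import Data.Nat.Solver using (module +-*-Solver)
open import Data.Product using (_×_; _,_; proj₁; proj₂; Σ)
open import Data.Product.Properties using (,-injectiveˡ)
open import Data.Sum using (_⊎_; inj₁; inj₂; [_,_]; [_,_]′)
open import Data.Sum.Properties using (≡-dec; inj₁-injective; inj₂-injective)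
import Data.Vec as Vec
open import Data.Vec.Properties using (lookup∘tabulate)
open import Function using (_∘_; const; id; _⇔_; mk⇔; Equivalence; Bijection)
open import Function.Properties.Equivalence using (⇔-isEquivalence)
open import Level using (0ℓ)
open import Relation.Binary.Construct.Closure.Equivalence as EqC using (EqClosure)
open import Relation.Binary.Construct.Closure.ReflexiveTransitive as Star using (_◅_; _◅◅_)
open import Relation.Binary.Construct.Closure.Symmetric using (fwd; bwd)
open import Relation.Binary.PropositionalEquality using (_≡_; _≢_; refl; sym; trans; cong; cong₂; subst; module ≡-Reasoning)
open import Relation.Nullary using (does; yes; no; contradiction; ¬_; Dec; ¬?)
open import Relation.Nullary.Decidable using (dec-true; dec-false; from-yes; _→-dec_; _×-dec_; _⊎-dec_; does-⇔)
open import Relation.Unary using (Pred; Decidable; Satisfiable; _⊆_)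

-- Darts at a vertex

module _ {m : ℕ} (M : Multipole m) where
  open Multipole M

  endsAt : Fin 2 → Fin #V → List (Fin #E)
  endsAt s v = filter (λ e → end e s ≟ v) (allFin #E)

  semiedgesAt : Fin #V → List (Fin m)
  semiedgesAt v = filter (λ i → ≡-dec _≟_ _≟_ (attach i) (inj₁ v)) (allFin m)

  dart : Fin 2 → Fin #E → Dart M
  dart s e = inj₁ (e , s)

  dartsAt : Fin #V → List (Dart M)
  dartsAt v = (map (dart 0F) (endsAt 0F v) ++ map (dart 1F) (endsAt 1F v)) ++ map inj₂ (semiedgesAt v)

  length-dartsAt : ∀ v → length (dartsAt v) ≡ 3
  length-dartsAt v = begin
    length ((xs ++ ys) ++ zs)          ≡⟨ length-++ (xs ++ ys) ⟩
    length (xs ++ ys) + length zs      ≡⟨ cong (_+ length zs) (length-++ xs) ⟩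
    length xs + length ys + length zs  ≡⟨ cong₂ _+_ (cong₂ _+_ (length-map (dart 0F) (endsAt 0F v))
                                                               (length-map (dart 1F) (endsAt 1F v)))
                                                    (length-map inj₂ (semiedgesAt v)) ⟩
    degree v                           ≡⟨ cubic v ⟩
    3                                  ∎
    where
    open ≡-Reasoning
    xs ys zs : List (Dart M)
    xs = map (dart 0F) (endsAt 0F v)
    ys = map (dart 1F) (endsAt 1F v)
    zs = map inj₂ (semiedgesAt v)

-- Finite sums and double counting of darts

onVertices : {V X : Set} → (V → Bool) → V ⊎ X → Bool
onVertices S = [ S , const false ]

-- General in the monoid because the handshake below serves twice: over ℕ to count vertices, edges
-- and semiedges, and over 𝔽₂ to sum flows across a cut.
module FiniteSums (CM : CommutativeMonoid 0ℓ 0ℓ) where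
  open CommutativeMonoid CM
    renaming (Carrier to A; refl to ≈-refl; sym to ≈-sym; trans to ≈-trans)
  open import Algebra.Properties.CommutativeMonoid.Sum CM public
  open import Algebra.Properties.CommutativeSemigroup commutativeSemigroup using (interchange)
  open import Relation.Binary.Reasoning.Setoid setoid

  infixl 8 _when_
  _when_ : A → Bool → A
  x when b = if b then x else ε

  sum-ε : ∀ {n} {f : Fin n → A} → (∀ i → f i ≈ ε) → sum f ≈ ε
  sum-ε {n} f≈ε = ≈-trans (sum-cong-≋ f≈ε) (sum-replicate-zero n)

  sum-single : ∀ {n} (f : Fin n → A) i → (∀ j → j ≢ i → f j ≈ ε) → sum f ≈ f i
  sum-single f zero    f≈ε = ≈-trans (∙-congˡ (sum-ε λ j → f≈ε (suc j) λ ())) (identityʳ _)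
  sum-single f (suc i) f≈ε =
    ≈-trans (∙-cong (f≈ε zero λ ()) (sum-single (f ∘ suc) i λ j j≢i → f≈ε (suc j) (j≢i ∘ suc-injective)))
            (identityˡ _)

  sum-when : ∀ {n} (f : Fin n → A) b → sum f when b ≈ sum (λ i → f i when b)
  sum-when f true  = ≈-refl
  sum-when f false = ≈-sym (sum-ε {f = λ i → f i when false} λ _ → ≈-refl)

  total : {B : Set} → (B → A) → List B → A
  total w = foldr (λ b s → w b ∙ s) ε

  total-++ : {B : Set} (w : B → A) (xs ys : List B) → total w (xs ++ ys) ≈ total w xs ∙ total w ys
  total-++ w []       ys = ≈-sym (identityˡ _)
  total-++ w (x ∷ xs) ys = ≈-trans (∙-congˡ (total-++ w xs ys)) (≈-sym (assoc _ _ _))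

  total-∙ : {B : Set} (u w : B → A) (xs : List B) → total (λ b → u b ∙ w b) xs ≈ total u xs ∙ total w xs
  total-∙ u w []       = ≈-sym (identityˡ ε)
  total-∙ u w (x ∷ xs) = ≈-trans (∙-congˡ (total-∙ u w xs)) (interchange (u x) (w x) (total u xs) (total w xs))

  total-map : {B C : Set} (w : C → A) (f : B → C) (xs : List B) → total w (map f xs) ≡ total (w ∘ f) xs
  total-map w f []       = refl
  total-map w f (x ∷ xs) = cong (w (f x) ∙_) (total-map w f xs)

  total-tabulate : ∀ {n} {B : Set} (w : B → A) (f : Fin n → B) → total w (tabulate f) ≡ sum (w ∘ f)
  total-tabulate {0}     w f = refl
  total-tabulate {suc n} w f = cong (w (f zero) ∙_) (total-tabulate w (f ∘ suc))

  total-filter : {B : Set} {P : Pred B 0ℓ} (P? : Decidable P) (w : B → A) (xs : List B) →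
                 total w (filter P? xs) ≈ total (λ b → w b when does (P? b)) xs
  total-filter P? w []       = ≈-refl
  total-filter P? w (x ∷ xs) with does (P? x)
  ... | true  = ∙-congˡ (total-filter P? w xs)
  ... | false = ≈-trans (total-filter P? w xs) (≈-sym (identityˡ _))

  -- Exchange of the two summations: `a` lies in the fibre of the vertex `f a`, or in none if `f a`
  -- is in `X`, as for a semiedge of a free edge. The condition on `does` lets one proof cover the
  -- different decision procedures used for edge ends and for semiedges.
  sum-fibres : ∀ {n k} {X : Set} (f : Fin k → Fin n ⊎ X) {P : Fin n → Pred (Fin k) 0ℓ}
               (P? : ∀ v → Decidable (P v)) →
               (∀ v a → does (P? v a) ≡ onVertices (λ u → does (u ≟ v)) (f a)) →
               (w : Fin k → A) (S : Fin n → Bool) →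
               sum (λ v → total w (filter (P? v) (allFin k)) when S v) ≈ sum (λ a → w a when onVertices S (f a))
  sum-fibres {n} {k} f P? P?≡ w S = begin
    sum (λ v → total w (filter (P? v) (allFin k)) when S v)                        ≈⟨ sum-cong-≋ expand ⟩
    sum (λ v → sum (λ a → (w a when onVertices (λ u → does (u ≟ v)) (f a)) when S v)) ≈⟨ ∑-comm (λ v a → (w a when onVertices (λ u → does (u ≟ v)) (f a)) when S v) ⟩
    sum (λ a → sum (λ v → (w a when onVertices (λ u → does (u ≟ v)) (f a)) when S v)) ≈⟨ sum-cong-≋ (λ a → collapse (w a) (f a)) ⟩
    sum (λ a → w a when onVertices S (f a))                                        ∎
    where
    when-congˡ : ∀ {x y} b → x ≈ y → x when b ≈ y when b
    when-congˡ true  x≈y = x≈y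
    when-congˡ false _   = ≈-refl

    expand : ∀ v → total w (filter (P? v) (allFin k)) when S v
                 ≈ sum (λ a → (w a when onVertices (λ u → does (u ≟ v)) (f a)) when S v)
    expand v = begin
      total w (filter (P? v) (allFin k)) when S v                  ≈⟨ when-congˡ (S v) (total-filter (P? v) w (allFin k)) ⟩
      total (λ a → w a when does (P? v a)) (allFin k) when S v     ≡⟨ cong (_when S v) (total-tabulate (λ a → w a when does (P? v a)) id) ⟩
      sum (λ a → w a when does (P? v a)) when S v                  ≡⟨ cong (_when S v) (sum-cong-≗ λ a → cong (w a when_) (P?≡ v a)) ⟩
      sum (λ a → w a when onVertices (λ u → does (u ≟ v)) (f a)) when S v  ≈⟨ sum-when (λ a → w a when onVertices (λ u → does (u ≟ v)) (f a)) (S v) ⟩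
      sum (λ a → (w a when onVertices (λ u → does (u ≟ v)) (f a)) when S v) ∎

    ε-when : ∀ b → ε when b ≈ ε
    ε-when true  = ≈-refl
    ε-when false = ≈-refl

    collapse : ∀ x t → sum (λ v → (x when onVertices (λ u → does (u ≟ v)) t) when S v) ≈ x when onVertices S t
    collapse x (inj₂ _) = sum-ε λ v → ε-when (S v)
    collapse x (inj₁ u) = begin
      sum (λ v → (x when does (u ≟ v)) when S v)  ≈⟨ sum-single (λ v → (x when does (u ≟ v)) when S v) u off ⟩
      (x when does (u ≟ u)) when S u              ≡⟨ cong (λ b → (x when b) when S u) (dec-true (u ≟ u) refl) ⟩
      x when S u                                  ∎
      where
      off : ∀ v → v ≢ u → (x when does (u ≟ v)) when S v ≈ ε
      off v v≢u = begin
        (x when does (u ≟ v)) when S v  ≡⟨ cong (λ b → (x when b) when S v) (dec-false (u ≟ v) (v≢u ∘ sym)) ⟩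
        ε when S v                      ≈⟨ ε-when (S v) ⟩
        ε                               ∎

  module _ {m : ℕ} (M : Multipole m) where
    open Multipole M

    -- Each dart at a vertex of `S` is counted once, either through its vertex or through its edge
    -- or semiedge.
    handshake : (w : Dart M → A) (S : Fin #V → Bool) →
                sum (λ v → total w (dartsAt M v) when S v)
                ≈ (sum (λ e → w (inj₁ (e , 0F)) when S (end e 0F)) ∙ sum (λ e → w (inj₁ (e , 1F)) when S (end e 1F)))
                  ∙ sum (λ i → w (inj₂ i) when onVertices S (attach i))
    handshake w S = begin
      sum (λ v → total w (dartsAt M v) when S v)  ≈⟨ sum-cong-≋ split ⟩
      sum (λ v → (s₀ v ∙ s₁ v) ∙ s₂ v)            ≈⟨ ∑-distrib-+ (λ v → s₀ v ∙ s₁ v) s₂ ⟩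
      sum (λ v → s₀ v ∙ s₁ v) ∙ sum s₂            ≈⟨ ∙-congʳ (∑-distrib-+ s₀ s₁) ⟩
      (sum s₀ ∙ sum s₁) ∙ sum s₂                  ≈⟨ ∙-cong (∙-cong (fibres 0F) (fibres 1F)) semifibres ⟩
      _                                           ∎
      where
      s₀ s₁ s₂ : Fin #V → A
      s₀ v = total (w ∘ dart M 0F) (endsAt M 0F v) when S v
      s₁ v = total (w ∘ dart M 1F) (endsAt M 1F v) when S v
      s₂ v = total (w ∘ inj₂) (semiedgesAt M v) when S v

      split : ∀ v → total w (dartsAt M v) when S v ≈ (s₀ v ∙ s₁ v) ∙ s₂ v
      split v with S v
      ... | false = ≈-sym (≈-trans (identityʳ _) (identityˡ _))
      ... | true  = begin
        total w ((xs ++ ys) ++ zs)                ≈⟨ total-++ w (xs ++ ys) zs ⟩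
        total w (xs ++ ys) ∙ total w zs           ≈⟨ ∙-congʳ (total-++ w xs ys) ⟩
        (total w xs ∙ total w ys) ∙ total w zs    ≡⟨ cong₂ _∙_ (cong₂ _∙_ (total-map w (dart M 0F) (endsAt M 0F v))
                                                                          (total-map w (dart M 1F) (endsAt M 1F v)))
                                                               (total-map w inj₂ (semiedgesAt M v)) ⟩
        _                                         ∎
        where
        xs ys zs : List (Dart M)
        xs = map (dart M 0F) (endsAt M 0F v)
        ys = map (dart M 1F) (endsAt M 1F v)
        zs = map inj₂ (semiedgesAt M v)

      fibres : ∀ s → sum (λ v → total (w ∘ dart M s) (endsAt M s v) when S v)
                     ≈ sum (λ e → w (inj₁ (e , s)) when S (end e s))
      -- An edge end always lies at a vertex, so the second summand of the target is left empty.
      fibres s = sum-fibres {X = Fin 0} (λ e → inj₁ (end e s)) (λ v e → end e s ≟ v) (λ _ _ → refl) (w ∘ dart M s) S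

      does-≡-dec : ∀ {n k} (t : Fin n ⊎ Fin k) v → does (≡-dec _≟_ _≟_ t (inj₁ v)) ≡ onVertices (λ u → does (u ≟ v)) t
      does-≡-dec (inj₁ u) v = refl
      does-≡-dec (inj₂ _) v = refl

      semifibres : sum s₂ ≈ sum (λ i → w (inj₂ i) when onVertices S (attach i))
      semifibres = sum-fibres attach (λ v i → ≡-dec _≟_ _≟_ (attach i) (inj₁ v)) (λ v i → does-≡-dec (attach i) v)
                              (w ∘ inj₂) S

module ℕSum = FiniteSums +-0-commutativeMonoid
module 𝔽₂Sum = FiniteSums (CommutativeRing.+-commutativeMonoid xor-∧-commutativeRing)

-- Sums of indicators over ℕ

module _ where
  open ℕSum

  sum-mono-≤ : ∀ {n} {f g : Fin n → ℕ} → (∀ i → f i ≤ g i) → sum f ≤ sum g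
  sum-mono-≤ {0}     f≤g = z≤n
  sum-mono-≤ {suc n} f≤g = +-mono-≤ (f≤g zero) (sum-mono-≤ (f≤g ∘ suc))

  sum-indicator : ∀ {n} (i : Fin n) x → sum (λ j → x when does (j ≟ i)) ≡ x
  sum-indicator i x = trans (sum-single _ i λ j j≢i → cong (x when_) (dec-false (j ≟ i) j≢i))
                            (cong (x when_) (dec-true (i ≟ i) refl))

  1-when≤1 : ∀ b → 1 when b ≤ 1
  1-when≤1 true  = ≤-refl
  1-when≤1 false = z≤n

  sum-const : ∀ n c → sum {n} (const c) ≡ n * c
  sum-const 0       c = refl
  sum-const (suc n) c = cong (c +_) (sum-const n c)

  ≤-sum : ∀ {n} (f : Fin n → ℕ) i → f i ≤ sum f
  ≤-sum f zero    = m≤m+n _ _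
  ≤-sum f (suc i) = ≤-trans (≤-sum (f ∘ suc) i) (m≤n+m _ _)

  sum-indicator≤n : ∀ {n} (b : Fin n → Bool) → sum (λ i → 1 when b i) ≤ n
  sum-indicator≤n {n} b = ≤-trans (sum-mono-≤ (1-when≤1 ∘ b)) (≤-reflexive (trans (sum-const n 1) (*-identityʳ n)))

  -- No term exceeds 1, so a single false one would keep the sum below `n`.
  full-sum : ∀ {n} (b : Fin n → Bool) → n ≤ sum (λ i → 1 when b i) → ∀ i → b i ≡ true
  full-sum {suc n} b n≤ i with b 0F in b₀
  full-sum {suc n} b n≤       i       | false = contradiction (≤-trans n≤ (sum-indicator≤n (b ∘ suc))) 1+n≰n
  full-sum {suc n} b n≤       zero    | true  = b₀
  full-sum {suc n} b (s≤s n≤) (suc i) | true  = full-sum (b ∘ suc) n≤ i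

-- Simple walks and cycles

module _ (G : Graph) where
  open Graph G
  open ℕSum

  -- Unlike `walkSources`, this includes the last vertex of the walk.
  data OnWalk (x : Fin #V) : ∀ {u v} → Walk G u v → Set where
    here  : ∀ {v} {p : Walk G x v} → OnWalk x p
    there : ∀ {u v w e} {j : Joins G e u v} {p : Walk G v w} → OnWalk x p → OnWalk x (step e j p)

  onWalk? : ∀ x {u v} (p : Walk G u v) → Dec (OnWalk x p)
  onWalk? x {u} p with x ≟ u
  ... | yes refl = yes here
  onWalk? x stop         | no x≢u = no λ { here → x≢u refl }
  onWalk? x (step e j p) | no x≢u with onWalk? x p
  ... | yes x∈p = yes (there x∈p)
  ... | no  x∉p = no λ { here → x≢u refl ; (there x∈p) → x∉p x∈p }

  data Simple : ∀ {u v} → Walk G u v → Set where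
    stop : ∀ {u} → Simple (stop {u = u})
    step : ∀ {u v w e} {j : Joins G e u v} {p : Walk G v w} → ¬ OnWalk u p → Simple p → Simple (step e j p)

  SimpleWalk : List (Fin #E) → Fin #V → Fin #V → Set
  SimpleWalk es u v = Σ (Walk G u v) λ p → Simple p × All (_∈ es) (walkEdges G p)

  suffix : ∀ {es x u v} {p : Walk G u v} → OnWalk x p → Simple p → All (_∈ es) (walkEdges G p) → SimpleWalk es x v
  suffix here        simple       p⊆es       = _ , simple , p⊆es
  suffix (there x∈p) (step _ s) (_ ∷ p⊆es) = suffix x∈p s p⊆es

  stepSimple : ∀ {es u v w} e → e ∈ es → Joins G e u v → SimpleWalk es v w → SimpleWalk es u w
  stepSimple {u = u} e e∈es j (p , s , p⊆es) with onWalk? u p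
  -- The walk returns to `u`: drop `e` and everything before that visit.
  ... | yes u∈p = suffix u∈p s p⊆es
  ... | no  u∉p = step e j p , step u∉p s , e∈es ∷ p⊆es

  simple-++ : ∀ {es u v w} → SimpleWalk es u v → SimpleWalk es v w → SimpleWalk es u w
  simple-++ (stop , _) q = q
  simple-++ (step e j p , step _ s , e∈es ∷ p⊆es) q = stepSimple e e∈es j (simple-++ (p , s , p⊆es) q)

  last-on : ∀ {u v} (p : Walk G u v) → OnWalk v p
  last-on stop         = here
  last-on (step _ _ p) = there (last-on p)

  source-on : ∀ {x u v} (p : Walk G u v) → x ∈ walkSources G p → OnWalk x p
  source-on (step _ _ p) (here refl) = here
  source-on (step _ _ p) (there x∈p) = there (source-on p x∈p)

  ends-on : ∀ {e u v} (p : Walk G u v) → e ∈ walkEdges G p → OnWalk (end e 0F) p × OnWalk (end e 1F) p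
  ends-on (step _ (inj₁ (refl , refl)) p) (here refl) = here , there here
  ends-on (step _ (inj₂ (refl , refl)) p) (here refl) = there here , here
  ends-on (step _ _ p)                    (there e∈p) = let (p₀ , p₁) = ends-on p e∈p in there p₀ , there p₁

  source-joins : ∀ {e u v} {R : Fin #V → Set} → Joins G e u v → R (end e 0F) × R (end e 1F) → R u
  source-joins (inj₁ (refl , _)) (r₀ , _) = r₀
  source-joins (inj₂ (_ , refl)) (_ , r₁) = r₁

  last-not-source : ∀ {u v} {p : Walk G u v} → Simple p → v ∉ walkSources G p
  last-not-source (step {p = p} u∉p s) (here refl)  = u∉p (last-on p)
  last-not-source (step u∉p s)         (there v∈p) = last-not-source s v∈p

  unique-sources : ∀ {u v} {p : Walk G u v} → Simple p → Unique (walkSources G p)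
  unique-sources stop                 = []
  unique-sources (step {p = p} u∉p s) = All.tabulate (λ { x∈p refl → u∉p (source-on p x∈p) }) ∷ unique-sources s

  -- If the first edge occurred again, both its ends, among them the start `u`, would lie on the
  -- rest of the walk.
  unique-edges : ∀ {u v} {p : Walk G u v} → Simple p → Unique (walkEdges G p)
  unique-edges stop                         = []
  unique-edges (step {j = j} {p = p} u∉p s) =
    All.tabulate (λ { e∈p refl → u∉p (source-joins {R = λ x → OnWalk x p} j (ends-on p e∈p)) }) ∷ unique-edges s

  -- The base is the last vertex of the simple walk and therefore none of its sources. If `e` is a
  -- loop, the simple walk is empty and the cycle has length 1.
  closing-edge : ∀ {es} e → e ∉ es → SimpleWalk es (end e 1F) (end e 0F) → Cycle G
  closing-edge e e∉es (p , s , p⊆es) = record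
    { base             = end e 0F
    ; walk             = step e (inj₁ (refl , refl)) p
    ; nonempty         = s≤s z≤n
    ; distinctEdges    = All.map (λ { x∈es refl → e∉es x∈es }) p⊆es ∷ unique-edges s
    ; distinctVertices = All.tabulate (λ { x∈p refl → last-not-source s x∈p }) ∷ unique-sources s
    }

  -- Connected components of an edge set by union-find

  merge : (a b x : Fin #V) → Fin #V
  merge a b x = if does (x ≟ a) then b else x

  -- Union-find: a representative of the connected component of a vertex in
  -- the subgraph with edges es.
  root : List (Fin #E) → Fin #V → Fin #V
  root []       x = x
  root (e ∷ es) x = merge (root es (end e 0F)) (root es (end e 1F)) (root es x)

  merge-left : ∀ a b → merge a b a ≡ b
  merge-left a b = cong (if_then b else a) (dec-true (a ≟ a) refl)

  merge-right : ∀ a b → merge a b b ≡ b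
  merge-right a b with does (b ≟ a)
  ... | true  = refl
  ... | false = refl

  root-ends : ∀ {e} es → e ∈ es → root es (end e 0F) ≡ root es (end e 1F)
  root-ends (e ∷ es) (here refl)  = trans (merge-left (root es (end e 0F)) _) (sym (merge-right (root es (end e 0F)) _))
  root-ends (e ∷ es) (there e′∈es) = cong (merge _ _) (root-ends es e′∈es)

  root-idem : ∀ es x → root es (root es x) ≡ root es x
  root-idem []       x = refl
  root-idem (e ∷ es) x with root es x ≟ root es (end e 0F)
  ... | yes _   = trans (cong (merge _ _) (root-idem es (end e 1F))) (merge-right (root es (end e 0F)) _)
  ... | no x≢e₀ = trans (cong (merge _ _) (root-idem es x)) (cong (if_then _ else _) (dec-false (_ ≟ _) x≢e₀))

  weaken : ∀ {e es u v} → SimpleWalk es u v → SimpleWalk (e ∷ es) u v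
  weaken (p , s , p⊆es) = p , s , All.map there p⊆es

  -- By induction on `es`: only the old class of `end e 0F` has been redirected, so if just one of
  -- `x`, `y` was in it, the walk crosses `e`; otherwise the old edges suffice. Walks are kept
  -- simple so that they can be closed up to cycles.
  root-connected : ∀ es {x y} → root es x ≡ root es y → SimpleWalk es x y
  root-connected []       refl = stop , stop , []
  root-connected (e ∷ es) {x} {y} eq with root es x ≟ root es (end e 0F) | root es y ≟ root es (end e 0F)
  ... | yes x~e₀ | yes y~e₀ = weaken (root-connected es (trans x~e₀ (sym y~e₀)))
  ... | yes x~e₀ | no  _    = simple-++ (weaken (root-connected es x~e₀))
                                        (stepSimple e (here refl) (inj₁ (refl , refl)) (weaken (root-connected es eq)))
  ... | no  _    | yes y~e₀ = simple-++ (weaken (root-connected es eq))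
                                        (stepSimple e (here refl) (inj₂ (refl , refl)) (weaken (root-connected es (sym y~e₀))))
  ... | no  _    | no  _    = weaken (root-connected es eq)

  acyclic⇒root-ends≢ : ¬ Cycle G → ∀ e es → e ∉ es → root es (end e 0F) ≢ root es (end e 1F)
  acyclic⇒root-ends≢ acyclic e es e∉es eq = acyclic (closing-edge e e∉es (root-connected es (sym eq)))

  isRoot : List (Fin #E) → Fin #V → Bool
  isRoot es v = does (root es v ≟ v)

  isRoot-root : ∀ es v → isRoot es (root es v) ≡ true
  isRoot-root es v = dec-true (_ ≟ _) (root-idem es v)

  -- Without cycles, each added edge joins two different classes, so it costs one root: the old root
  -- `a` of its first end.
  acyclic⇒edges+roots≤vertices : ¬ Cycle G → ∀ {es} → Unique es →
    length es + sum (λ v → 1 when isRoot es v) ≤ sum {#V} (const 1)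
  acyclic⇒edges+roots≤vertices acyclic {[]}     _ = sum-mono-≤ λ v → 1-when≤1 (isRoot [] v)
  acyclic⇒edges+roots≤vertices acyclic {e ∷ es} uq@(_ ∷ uqs) = begin
    suc (length es) + sum (λ v → 1 when isRoot (e ∷ es) v)
      ≡⟨ sym (+-suc (length es) _) ⟩
    length es + suc (sum (λ v → 1 when isRoot (e ∷ es) v))
      -- The 1 for the new edge is written as the indicator sum of the lost root `a`, to be compared
      -- vertex by vertex.
      ≡⟨ cong (λ k → length es + (k + sum (λ v → 1 when isRoot (e ∷ es) v))) (sym (sum-indicator a 1)) ⟩
    length es + (sum (λ v → 1 when does (v ≟ a)) + sum (λ v → 1 when isRoot (e ∷ es) v))
      ≡⟨ cong (length es +_) (sym (∑-distrib-+ (λ v → 1 when does (v ≟ a)) _)) ⟩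
    length es + sum (λ v → (1 when does (v ≟ a)) + (1 when isRoot (e ∷ es) v))
      ≤⟨ +-monoʳ-≤ (length es) (sum-mono-≤ roots-drop) ⟩
    length es + sum (λ v → 1 when isRoot es v)
      ≤⟨ acyclic⇒edges+roots≤vertices acyclic uqs ⟩
    sum {#V} (const 1)
      ∎
    where
    open ≤-Reasoning
    a = root es (end e 0F)
    b = root es (end e 1F)
    a≢b : a ≢ b
    a≢b = acyclic⇒root-ends≢ acyclic e es (Unique.Unique[x∷xs]⇒x∉xs uq)

    -- Had `v` been in the class of `a`, its new root would be `b`; then `v` is `b`, which is its
    -- own old root, against `a≢b`.
    survivor : ∀ v → v ≢ a → root (e ∷ es) v ≡ v → root es v ≡ v
    survivor v v≢a eq with root es v ≟ a
    ... | yes v~a = contradiction (trans (sym v~a) (trans (cong (root es) (sym eq)) (root-idem es (end e 1F)))) a≢b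
    ... | no  _   = eq

    roots-drop : ∀ v → (1 when does (v ≟ a)) + (1 when isRoot (e ∷ es) v) ≤ 1 when isRoot es v
    roots-drop v with v ≟ a
    ... | yes refl = ≤-reflexive (trans (cong (λ t → 1 + (1 when t)) absorbed)
                                        (cong (1 when_) (sym (isRoot-root es (end e 0F)))))
      where
      absorbed : isRoot (e ∷ es) a ≡ false
      absorbed = dec-false (_ ≟ _) λ eq →
        a≢b (trans (sym eq) (trans (cong (merge a b) (root-idem es (end e 0F))) (merge-left a b)))
    ... | no v≢a with root (e ∷ es) v ≟ v
    ...   | yes eq = ≤-reflexive (cong (1 when_) (sym (dec-true (_ ≟ _) (survivor v v≢a eq))))
    ...   | no _   = z≤n

  -- For S the indicator of a single vertex: a component has at most one more
  -- vertex than edges.  General S is needed since merging changes the indicator.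
  class-bound : ∀ es (S : Fin #V → Bool) →
    sum (λ v → 1 when S (root es v))
    ≤ sum (λ v → 1 when S v when isRoot es v) + total (λ e → 1 when S (root es (end e 0F))) es
  class-bound []       S = ≤-trans
    (≤-reflexive (sum-cong-≗ λ v → cong (1 when S v when_) (sym (dec-true (v ≟ v) refl))))
    (≤-reflexive (sym (+-identityʳ _)))
  class-bound (e ∷ es) S = begin
    sum (λ v → 1 when S (merge a b (root es v)))
      -- New roots are merged old roots, so the induction hypothesis is applied to the preimage of
      -- `S` under the merge.
      ≤⟨ class-bound es (S ∘ merge a b) ⟩
    sum (λ v → 1 when S (merge a b v) when isRoot es v) + T
      -- Only `a` can stop being a root. It is counted on the left exactly if `S b` holds, and this
      -- becomes the term of the edge `e`.
      ≤⟨ +-monoˡ-≤ T (sum-mono-≤ roots-kept) ⟩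
    sum (λ v → (1 when S v when isRoot (e ∷ es) v) + (1 when S b when does (v ≟ a))) + T
      ≡⟨ cong (_+ T) (∑-distrib-+ (λ v → 1 when S v when isRoot (e ∷ es) v) _) ⟩
    R + sum (λ v → 1 when S b when does (v ≟ a)) + T
      ≡⟨ cong (λ k → R + k + T) (sum-indicator a _) ⟩
    R + (1 when S b) + T
      ≡⟨ cong (λ x → R + (1 when S x) + T) (sym (merge-left a b)) ⟩
    R + (1 when S (merge a b a)) + T
      ≡⟨ +-assoc R _ T ⟩
    R + ((1 when S (merge a b a)) + T)
      ∎
    where
    open ≤-Reasoning
    a = root es (end e 0F)
    b = root es (end e 1F)
    R = sum (λ v → 1 when S v when isRoot (e ∷ es) v)
    T = total (λ e′ → 1 when S (root (e ∷ es) (end e′ 0F))) es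

    roots-kept : ∀ v → 1 when S (merge a b v) when isRoot es v
                       ≤ (1 when S v when isRoot (e ∷ es) v) + (1 when S b when does (v ≟ a))
    roots-kept v with root es v ≟ v
    ... | no _ = z≤n
    ... | yes v-root with v ≟ a
    ...   | yes _  = m≤n+m _ _
    ...   | no v≢a = ≤-trans (≤-reflexive (cong (1 when S v when_) (sym (dec-true (_ ≟ _) kept)))) (m≤m+n _ 0)
      where
      kept : root (e ∷ es) v ≡ v
      kept = trans (cong (merge a b) v-root) (cong (if_then b else v) (dec-false (v ≟ a) v≢a))

-- Counting vertices against semiedges

module _ {m : ℕ} (M : Multipole m) where
  open Multipole M
  open ℕSum

  -- The handshake with all weights 1. As `S` is closed under edges, every edge has both ends in it
  -- or neither.
  degree-sum : (S : Fin #V → Bool) → (∀ e → S (end e 0F) ≡ S (end e 1F)) →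
               3 * sum (λ v → 1 when S v)
               ≡ 2 * sum (λ e → 1 when S (end e 0F)) + sum (λ i → 1 when onVertices S (attach i))
  degree-sum S closed = begin
    3 * sum (λ v → 1 when S v)
      ≡⟨ triple (λ v → 1 when S v) ⟩
    sum (λ v → 3 * (1 when S v))
      ≡⟨ sum-cong-≗ degrees ⟩
    sum (λ v → total (const 1) (dartsAt M v) when S v)
      ≡⟨ handshake M (const 1) S ⟩
    sum (λ e → 1 when S (end e 0F)) + sum (λ e → 1 when S (end e 1F)) + I
      ≡⟨ cong (λ k → E + k + I) (sum-cong-≗ λ e → cong (1 when_) (sym (closed e))) ⟩
    E + E + I
      ≡⟨ cong (λ k → E + k + I) (sym (+-identityʳ E)) ⟩
    2 * E + I ∎
    where
    open ≡-Reasoning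
    E = sum (λ e → 1 when S (end e 0F))
    I = sum (λ i → 1 when onVertices S (attach i))

    triple : ∀ {n} (f : Fin n → ℕ) → 3 * sum f ≡ sum (λ i → 3 * f i)
    triple {0}     f = refl
    triple {suc n} f = trans (*-distribˡ-+ 3 (f zero) _) (cong (3 * f zero +_) (triple (f ∘ suc)))

    degrees : ∀ v → 3 * (1 when S v) ≡ total (const 1) (dartsAt M v) when S v
    degrees v with S v
    ... | true  = sym (length-dartsAt M v)
    ... | false = refl

  -- The degree sum gives `3 * #V ≤ 2 * #E + m`, and a nonempty forest has at least one root, whence
  -- `#E + 1 ≤ #V`.
  acyclic⇒#V+2≤m : Fin #V → ¬ Cycle graph → #V + 2 ≤ m
  acyclic⇒#V+2≤m v₀ acyclic = +-cancelˡ-≤ (2 * #V) (#V + 2) m (begin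
    2 * #V + (#V + 2)                          ≡⟨ solve 1 (λ n → con 2 :* n :+ (n :+ con 2) := con 3 :* (n :* con 1) :+ con 2) refl #V ⟩
    3 * (#V * 1) + 2                           ≡⟨ cong (λ k → 3 * k + 2) (sym (sum-const #V 1)) ⟩
    3 * sum {#V} (const 1) + 2                 ≡⟨ cong (_+ 2) (degree-sum (const true) (λ _ → refl)) ⟩
    2 * sum {#E} (const 1) + I + 2             ≡⟨ cong (λ k → 2 * k + I + 2) (trans (sum-const #E 1) (*-identityʳ #E)) ⟩
    2 * #E + I + 2                             ≤⟨ +-monoˡ-≤ 2 (+-monoʳ-≤ (2 * #E) (sum-indicator≤n (onVertices (const true) ∘ attach))) ⟩
    2 * #E + m + 2                             ≡⟨ solve 2 (λ e m → con 2 :* e :+ m :+ con 2 := con 2 :* (e :+ con 1) :+ m) refl #E m ⟩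
    2 * (#E + 1) + m                           ≤⟨ +-monoˡ-≤ m (*-monoʳ-≤ 2 #E<#V) ⟩
    2 * #V + m                                 ∎)
    where
    open ≤-Reasoning
    open +-*-Solver
    I = sum (λ i → 1 when onVertices (const true) (attach i))
    es = allFin #E

    someRoot : 1 ≤ sum (λ v → 1 when isRoot graph es v)
    someRoot = ≤-trans (≤-reflexive (cong (1 when_) (sym (isRoot-root graph es v₀)))) (≤-sum _ (root graph es v₀))

    #E<#V : #E + 1 ≤ #V
    #E<#V = begin
      #E + 1                                                 ≡⟨ cong (_+ 1) (sym (length-tabulate {n = #E} id)) ⟩
      length es + 1                                          ≤⟨ +-monoʳ-≤ (length es) (someRoot) ⟩
      length es + sum (λ v → 1 when isRoot graph es v)       ≤⟨ acyclic⇒edges+roots≤vertices graph acyclic (Unique.allFin⁺ #E) ⟩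
      sum {#V} (const 1)                                     ≡⟨ trans (sum-const #V 1) (*-identityʳ #V) ⟩
      #V                                                     ∎

  inComponent : Fin #V → Fin #V → Bool
  inComponent u v = does (root graph (allFin #E) v ≟ root graph (allFin #E) u)

  inComponent-edge : ∀ u e → inComponent u (end e 0F) ≡ inComponent u (end e 1F)
  inComponent-edge u e = cong (λ x → does (x ≟ _)) (root-ends graph (allFin #E) (∈-allFin e))

  -- Converse count, from connectedness instead of acyclicity: with `K` vertices and `E` edges in
  -- the component, `3 * K ≡ 2 * E + m` and `K ≤ 1 + E`.
  semiedges≤component+2 : ∀ u → (∀ i → onVertices (inComponent u) (attach i) ≡ true) →
                          m ≤ 2 + sum (λ v → 1 when inComponent u v)
  semiedges≤component+2 u all-on = +-cancelˡ-≤ (2 * K) m (2 + K) (begin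
    2 * K + m            ≤⟨ +-monoˡ-≤ m (*-monoʳ-≤ 2 K≤1+E) ⟩
    2 * (1 + E) + m      ≡⟨ solve 2 (λ e m → con 2 :* (con 1 :+ e) :+ m := con 2 :+ (con 2 :* e :+ m)) refl E m ⟩
    2 + (2 * E + m)      ≡⟨ cong (λ k → 2 + (2 * E + k)) (sym I≡m) ⟩
    2 + (2 * E + I)      ≡⟨ cong (2 +_) (sym (degree-sum (inComponent u) (inComponent-edge u))) ⟩
    2 + 3 * K            ≡⟨ solve 1 (λ k → con 2 :+ con 3 :* k := con 2 :* k :+ (con 2 :+ k)) refl K ⟩
    2 * K + (2 + K)      ∎)
    where
    open ≤-Reasoning
    open +-*-Solver
    es = allFin #E
    ρ = root graph es u
    K = sum (λ v → 1 when inComponent u v)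
    E = sum (λ e → 1 when inComponent u (end e 0F))
    I = sum (λ i → 1 when onVertices (inComponent u) (attach i))

    I≡m : I ≡ m
    I≡m = trans (sum-cong-≗ λ i → cong (1 when_) (all-on i)) (trans (sum-const m 1) (*-identityʳ m))

    when-≤ : ∀ x b → x when b ≤ x
    when-≤ x true  = ≤-refl
    when-≤ x false = z≤n

    K≤1+E : K ≤ 1 + E
    K≤1+E = begin
      K
        -- With `S` the singleton of the root `ρ`, the sum over roots is at most 1 and the edge
        -- terms count the edges of the component.
        ≤⟨ class-bound graph es (λ v → does (v ≟ ρ)) ⟩
      sum (λ v → 1 when does (v ≟ ρ) when isRoot graph es v) + total (λ e → 1 when inComponent u (end e 0F)) es
        ≤⟨ +-monoˡ-≤ (total (λ e → 1 when inComponent u (end e 0F)) es) (sum-mono-≤ λ v → when-≤ (1 when does (v ≟ ρ)) (isRoot graph es v)) ⟩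
      sum (λ v → 1 when does (v ≟ ρ)) + total (λ e → 1 when inComponent u (end e 0F)) es
        ≡⟨ cong₂ _+_ (sum-indicator ρ 1) (total-tabulate (λ e → 1 when inComponent u (end e 0F)) id) ⟩
      1 + E ∎

-- Flows over 𝔽₂ on acyclic multipoles

module _ {m : ℕ} (M : Multipole m) where
  open Multipole M
  open 𝔽₂Sum

  incident-dartsAt : ∀ v → All (λ d → Incident M d v) (dartsAt M v)
  incident-dartsAt v =
    All.++⁺ (All.++⁺ (All.map⁺ (All.all-filter (λ e → end e 0F ≟ v) (allFin #E)))
                     (All.map⁺ (All.all-filter (λ e → end e 1F ≟ v) (allFin #E))))
            (All.map⁺ (All.all-filter (λ i → ≡-dec _≟_ _≟_ (attach i) (inj₁ v)) (allFin m)))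

  -- Provides the inequalities of darts that `proper` asks for.
  unique-dartsAt : ∀ v → Unique (dartsAt M v)
  unique-dartsAt v =
    Unique.++⁺ (Unique.++⁺ (Unique.map⁺ (,-injectiveˡ ∘ inj₁-injective) (Unique.filter⁺ _ (Unique.allFin⁺ #E)))
                           (Unique.map⁺ (,-injectiveˡ ∘ inj₁-injective) (Unique.filter⁺ _ (Unique.allFin⁺ #E)))
                           disjoint-ends)
               (Unique.map⁺ inj₂-injective (Unique.filter⁺ _ (Unique.allFin⁺ m)))
               disjoint-semiedges
    where
    disjoint-ends : ∀ {d} → ¬ (d ∈ map (dart M 0F) (endsAt M 0F v) × d ∈ map (dart M 1F) (endsAt M 1F v))
    disjoint-ends (p , q) with ∈-map⁻ (dart M 0F) p | ∈-map⁻ (dart M 1F) q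
    ... | _ , _ , refl | _ , _ , ()

    edge-darts : All (λ d → ∀ i → d ≢ inj₂ i) (map (dart M 0F) (endsAt M 0F v) ++ map (dart M 1F) (endsAt M 1F v))
    edge-darts = All.++⁺ (All.map⁺ (All.universal (λ _ _ ()) (endsAt M 0F v)))
                         (All.map⁺ (All.universal (λ _ _ ()) (endsAt M 1F v)))

    disjoint-semiedges : ∀ {d} → ¬ (d ∈ map (dart M 0F) (endsAt M 0F v) ++ map (dart M 1F) (endsAt M 1F v)
                                    × d ∈ map inj₂ (semiedgesAt M v))
    disjoint-semiedges (p , q) with ∈-map⁻ inj₂ q
    ... | i , _ , eq = All.lookup edge-darts p i eq

  -- The two sides of the edge e in the graph without e form a cut whose only edge is e.
  acyclic⇒zero-flow : ¬ Cycle graph → (f : Fin #E ⊎ Fin m → Bool) →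
                      (∀ v → total (f ∘ carrier M) (dartsAt M v) ≡ false) →
                      (∀ i → f (inj₂ i) ≡ false) → ∀ e → f (inj₁ e) ≡ false
  acyclic⇒zero-flow acyclic f flow boundary e = sym (begin
    false
      ≡⟨ sym (sum-ε λ v → trans (cong (_when S v) (flow v)) (false-when (S v))) ⟩
    sum (λ v → total (f ∘ carrier M) (dartsAt M v) when S v)
      ≡⟨ handshake M (f ∘ carrier M) S ⟩
    (sum f₀ xor sum f₁) xor sum (λ i → f (inj₂ i) when onVertices S (attach i))
      ≡⟨ cong₂ _xor_ (sym (∑-distrib-+ f₀ f₁))
                     (sum-ε λ i → trans (cong (_when onVertices S (attach i)) (boundary i)) (false-when (onVertices S (attach i)))) ⟩
    sum (λ e′ → f₀ e′ xor f₁ e′) xor false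
      ≡⟨ xor-identityʳ _ ⟩
    sum (λ e′ → f₀ e′ xor f₁ e′)
      -- Any other edge has both ends on the same side of the cut, so its two contributions cancel
      -- in 𝔽₂.
      ≡⟨ sum-single (λ e′ → f₀ e′ xor f₁ e′) e other-edges ⟩
    f₀ e xor f₁ e
      ≡⟨ cong₂ (λ a b → (f (inj₁ e) when a) xor (f (inj₁ e) when b)) (dec-true (root graph es (end e 0F) ≟ _) refl)
               (dec-false (_ ≟ _) (acyclic⇒root-ends≢ graph acyclic e es e∉es ∘ sym)) ⟩
    f (inj₁ e) xor false
      ≡⟨ xor-identityʳ _ ⟩
    f (inj₁ e) ∎)
    where
    open ≡-Reasoning
    es = filter (λ e′ → ¬? (e′ ≟ e)) (allFin #E)
    S : Fin #V → Bool
    S v = does (root graph es v ≟ root graph es (end e 0F))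
    f₀ f₁ : Fin #E → Bool
    f₀ e′ = f (inj₁ e′) when S (end e′ 0F)
    f₁ e′ = f (inj₁ e′) when S (end e′ 1F)

    e∉es : e ∉ es
    e∉es e∈es = proj₂ (∈-filter⁻ (λ e′ → ¬? (e′ ≟ e)) {xs = allFin #E} e∈es) refl

    false-when : ∀ b → false when b ≡ false
    false-when true  = refl
    false-when false = refl

    other-edges : ∀ e′ → e′ ≢ e → f₀ e′ xor f₁ e′ ≡ false
    other-edges e′ e′≢e = trans (cong (λ x → f₀ e′ xor (f (inj₁ e′) when does (x ≟ _))) (sym same-side)) (xor-same (f₀ e′))
      where
      same-side = root-ends graph es (∈-filter⁺ (λ e′ → ¬? (e′ ≟ e)) (∈-allFin e′) e′≢e)

-- Colours as nonzero elements of 𝔽₄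

rotate : Colour → Colour
rotate 0F = 1F
rotate 1F = 2F
rotate 2F = 0F

turn : ℕ → Colour → Colour
turn k c = iterate rotate c k

-- Colours are the nonzero elements of 𝔽₂², or of 𝔽₄, where rotate is
-- multiplication by a generator; coord c is the linear form that vanishes at c.
coord : Colour → Colour → Bool
coord c x = not (does (x ≟ c))

-- The three nonzero vectors of 𝔽₂² sum to zero. The final `xor false` matches `total` over a list
-- of three darts.
coord-distinct : ∀ c x y z → x ≢ y → x ≢ z → y ≢ z → coord c x xor (coord c y xor (coord c z xor false)) ≡ false
coord-distinct = from-yes (all? λ c → all? λ x → all? λ y → all? λ z →
  ¬? (x ≟ y) →-dec (¬? (x ≟ z) →-dec (¬? (y ≟ z) →-dec (coord c x xor (coord c y xor (coord c z xor false)) Bool.≟ false))))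

-- The linear form `coord c` applied to `x + ω y + ω² z`.
twisted : Colour → Colour → Colour → Colour → Bool
twisted c x y z = coord c x xor (coord c (turn 1 y) xor coord c (turn 2 z))

twisted-fixed : ∀ c x → twisted c x x x ≡ false
twisted-fixed = from-yes (all? λ c → all? λ x → twisted c x x x Bool.≟ false)

twisted-turning : ∀ c x → twisted c x (turn 1 x) (turn 2 x) ≡ false
twisted-turning = from-yes (all? λ c → all? λ x → twisted c x (turn 1 x) (turn 2 x) Bool.≟ false)

-- If all the forms vanish, then `x + ω y + ω² z` is zero and its three terms are distinct. So
-- `(ω y, ω² z)` is `(ω x, ω² x)` or `(ω² x, ω x)`; dividing by ω and ω² gives the two cases.
twisted-zero : ∀ x y z → (∀ c → twisted c x y z ≡ false) → (y ≡ x × z ≡ x) ⊎ (y ≡ turn 1 x × z ≡ turn 2 x)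
twisted-zero = from-yes (all? λ x → all? λ y → all? λ z → all? (λ c → twisted c x y z Bool.≟ false)
  →-dec ((y ≟ x ×-dec z ≟ x) ⊎-dec (y ≟ turn 1 x ×-dec z ≟ turn 2 x)))

turn-injective : ∀ k {x y} → turn k x ≡ turn k y → x ≡ y
turn-injective 0         eq = eq
turn-injective (suc k) eq = rotate-injective _ _ (turn-injective k eq)
  where
  rotate-injective : ∀ x y → rotate x ≡ rotate y → x ≡ y
  rotate-injective = from-yes (all? λ x → all? λ y → rotate x ≟ rotate y →-dec x ≟ y)

-- The multiples `x`, `ω x`, `ω² x` exhaust the colours. The negative form accepts directly the
-- properness of three colourings.
turn-covers : ∀ x y → x ≢ y → turn 1 x ≢ y → turn 2 x ≢ y → ⊥
turn-covers = from-yes (all? λ x → all? λ y →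
  ¬? (x ≟ y) →-dec (¬? (turn 1 x ≟ y) →-dec (¬? (turn 2 x ≟ y) →-dec no id)))

rotate-moves : ∀ x → rotate x ≢ x
rotate-moves = from-yes (all? λ x → ¬? (rotate x ≟ x))

module _ {m : ℕ} (M : Multipole m) where
  open Multipole M
  open 𝔽₂Sum

  turn-colouring : ∀ k {φ} → IsTaitColouring M φ → IsTaitColouring M (turn k ∘ φ)
  turn-colouring k tait = record
    { proper = λ d∈v d′∈v d≢d′ → proper d∈v d′∈v d≢d′ ∘ turn-injective k
    ; free   = cong (turn k) ∘ free
    }
    where open IsTaitColouring tait

  -- The three darts at `v` have distinct colours, so their coordinates sum to zero.
  colouring-flow : ∀ {φ} → IsTaitColouring M φ → ∀ c v → total (coord c ∘ φ ∘ carrier M) (dartsAt M v) ≡ false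
  colouring-flow {φ} tait c v = three (dartsAt M v) (length-dartsAt M v) (unique-dartsAt M v) (incident-dartsAt M v)
    where
    open IsTaitColouring tait
    three : ∀ ds → length ds ≡ 3 → Unique ds → All (λ d → Incident M d v) ds →
            total (coord c ∘ φ ∘ carrier M) ds ≡ false
    three (_ ∷ _ ∷ _ ∷ []) refl ((x≢y ∷ x≢z ∷ []) ∷ (y≢z ∷ []) ∷ [] ∷ []) (x∈v ∷ y∈v ∷ z∈v ∷ []) =
      coord-distinct c _ _ _ (proper x∈v y∈v x≢y) (proper x∈v z∈v x≢z) (proper y∈v z∈v y≢z)

-- Fixed and turning edges

module _ {m : ℕ} (T : Multipole m)
         (acyclic : ¬ Cycle (Multipole.graph T)) (connected : ∀ x y → EqClosure (Adjacent T) x y)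
         (φ : ℕ → Fin (Multipole.#E T) ⊎ Fin m → Colour) (tait : ∀ k → IsTaitColouring T (φ k))
         (A : Fin m → Bool) (s : Fin m → Colour)
         (boundary : ∀ k i → φ k (inj₂ i) ≡ (if A i then turn k (s i) else s i)) where
  open Multipole T
  open 𝔽₂Sum

  private
    Fixed Turning : Fin #E ⊎ Fin m → Set
    Fixed x   = φ 1 x ≡ φ 0 x × φ 2 x ≡ φ 0 x
    Turning x = φ 1 x ≡ turn 1 (φ 0 x) × φ 2 x ≡ turn 2 (φ 0 x)

  boundary-turning : ∀ i → A i ≡ true → Turning (inj₂ i)
  boundary-turning i Ai with A i | boundary 0 i | boundary 1 i | boundary 2 i
  boundary-turning i refl | true | b₀ | b₁ | b₂ rewrite b₀ = b₁ , b₂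

  boundary-fixed : ∀ i → A i ≡ false → Fixed (inj₂ i)
  boundary-fixed i Ai with A i | boundary 0 i | boundary 1 i | boundary 2 i
  boundary-fixed i refl | false | b₀ | b₁ | b₂ = trans b₁ (sym b₀) , trans b₂ (sym b₀)

  boundary-kind : ∀ i → Fixed (inj₂ i) ⊎ Turning (inj₂ i)
  boundary-kind i with A i in Ai
  ... | true  = inj₂ (boundary-turning i Ai)
  ... | false = inj₁ (boundary-fixed i Ai)

  kind : ∀ x → Fixed x ⊎ Turning x
  kind (inj₂ i) = boundary-kind i
  kind (inj₁ e) = twisted-zero _ _ _ λ c →
    acyclic⇒zero-flow T acyclic (f c) (flow c) (λ i → [ fixed⇒zero c , turning⇒zero c ]′ (boundary-kind i)) e
    where
    f : Colour → Fin #E ⊎ Fin m → Bool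
    f c x = twisted c (φ 0 x) (φ 1 x) (φ 2 x)

    fixed⇒zero : ∀ c {x} → Fixed x → f c x ≡ false
    fixed⇒zero c {x} (eq₁ , eq₂) rewrite eq₁ | eq₂ = twisted-fixed c (φ 0 x)

    turning⇒zero : ∀ c {x} → Turning x → f c x ≡ false
    turning⇒zero c {x} (eq₁ , eq₂) rewrite eq₁ | eq₂ = twisted-turning c (φ 0 x)

    -- Each `turn k ∘ φ k` is again a Tait colouring, so its coordinates form a flow; `f c` is the
    -- sum of three of these.
    flow : ∀ c v → total (f c ∘ carrier T) (dartsAt T v) ≡ false
    flow c v = begin
      total (f c ∘ carrier T) ds                            ≡⟨ total-∙ (g 0) _ ds ⟩
      total (g 0) ds xor total (λ d → g 1 d xor g 2 d) ds   ≡⟨ cong (total (g 0) ds xor_) (total-∙ (g 1) (g 2) ds) ⟩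
      total (g 0) ds xor (total (g 1) ds xor total (g 2) ds)
        ≡⟨ cong₂ _xor_ (zero-flow 0) (cong₂ _xor_ (zero-flow 1) (zero-flow 2)) ⟩
      false ∎
      where
      open ≡-Reasoning
      ds = dartsAt T v
      g : ℕ → Dart T → Bool
      g k d = coord c (turn k (φ k (carrier T d)))
      zero-flow : ∀ k → total (g k) ds ≡ false
      zero-flow k = colouring-flow T (turn-colouring T k (tait k)) c v

  -- The fixed colour would have to avoid the turning one in all three colourings, that is, avoid
  -- every colour.
  ¬turning∧fixed : ∀ {v d d′} → Incident T d v → Incident T d′ v →
                    Turning (carrier T d) → Fixed (carrier T d′) → ⊥
  ¬turning∧fixed {d = d} {d′} d∈v d′∈v (t₁ , t₂) (f₁ , f₂) = turn-covers (φ 0 (carrier T d)) (φ 0 (carrier T d′))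
    (proper (tait 0) d∈v d′∈v d≢d′)
    (λ eq → proper (tait 1) d∈v d′∈v d≢d′ (trans t₁ (trans eq (sym f₁))))
    (λ eq → proper (tait 2) d∈v d′∈v d≢d′ (trans t₂ (trans eq (sym f₂))))
    where
    open IsTaitColouring
    d≢d′ : d ≢ d′
    d≢d′ refl = rotate-moves _ (trans (sym t₁) f₁)

  same-kind : ∀ {v d d′} → Incident T d v → Incident T d′ v → Turning (carrier T d) → Turning (carrier T d′)
  same-kind {d′ = d′} d∈v d′∈v t with kind (carrier T d′)
  ... | inj₁ f  = contradiction f (¬turning∧fixed d∈v d′∈v t)
  ... | inj₂ t′ = t′

  private
    -- Extended from edges and semiedges to nodes so that it can be transported along `Adjacent`.
    NodeTurning : Node T → Set
    NodeTurning (inj₁ v) = ∀ d → Incident T d v → Turning (carrier T d)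
    NodeTurning (inj₂ i) = Turning (inj₂ i)

  adjacent-turning : ∀ {x y} → Adjacent T x y → NodeTurning x ⇔ NodeTurning y
  adjacent-turning (edge e) = mk⇔
    (λ t d d∈v → same-kind {d = inj₁ (e , 1F)} {d} refl d∈v (t (inj₁ (e , 0F)) refl))
    (λ t d d∈v → same-kind {d = inj₁ (e , 0F)} {d} refl d∈v (t (inj₁ (e , 1F)) refl))
  adjacent-turning (semiedge i) with attach i in eq
  ... | inj₁ v = mk⇔ (λ t d d∈v → same-kind {d = inj₂ i} {d} eq d∈v t) (λ t → t (inj₂ i) eq)
  ... | inj₂ j = mk⇔ (transport mates) (transport (sym ∘ mates))
    where
    mates : ∀ k → φ k (inj₂ i) ≡ φ k (inj₂ j)
    mates k = IsTaitColouring.free (tait k) eq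
    transport : ∀ {x y} → (∀ k → φ k x ≡ φ k y) → Turning x → Turning y
    transport x≗y (t₁ , t₂) = trans (sym (x≗y 1)) (trans t₁ (cong (turn 1) (x≗y 0)))
                            , trans (sym (x≗y 2)) (trans t₂ (cong (turn 2) (x≗y 0)))

  -- Turning spreads from semiedge `i` to all of the connected `T`; were `A j` false, semiedge `j`
  -- would be fixed as well, but `rotate` moves every colour.
  boundary-constant : ∀ i j → A i ≡ true → A j ≡ true
  boundary-constant i j Ai with A j in Aj
  ... | true  = refl
  ... | false = contradiction (trans (sym (proj₁ turning)) (proj₁ (boundary-fixed j Aj))) (rotate-moves _)
    where
    turning : Turning (inj₂ j)
    turning = Equivalence.to (EqC.gfold ⇔-isEquivalence NodeTurning adjacent-turning (connected (inj₂ i) (inj₂ j)))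
                             (boundary-turning i Ai)

-- Turning the colours on a union of components

does-true : {P : Set} (P? : Dec P) → does P? ≡ true → P
does-true (yes p) _ = p
does-true (no _)  ()

Connected : ∀ {m} → Multipole m → Set
Connected M = ∀ x y → EqClosure (Adjacent M) x y

-- Such a `c` is the indicator of a union of components.
ComponentLabelling : ∀ {m} (M : Multipole m) → (Node M → Bool) → Set
ComponentLabelling M c = ∀ {x y} → Adjacent M x y → c x ≡ c y

module _ {m : ℕ} (M : Multipole m)
         (c : Node M → Bool) (labelling : ComponentLabelling M c) where
  open Multipole M

  carrierLabel : Fin #E ⊎ Fin m → Bool
  carrierLabel (inj₁ e) = c (inj₁ (end e 0F))
  carrierLabel (inj₂ i) = c (inj₂ i)

  carrierLabel-incident : ∀ {v} d → Incident M d v → carrierLabel (carrier M d) ≡ c (inj₁ v)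
  carrierLabel-incident (inj₁ (e , 0F)) refl = refl
  carrierLabel-incident (inj₁ (e , 1F)) refl = labelling (edge e)
  carrierLabel-incident (inj₂ i)        eq   = trans (labelling (semiedge i)) (cong c eq)

  turnLabelled : ℕ → (Fin #E ⊎ Fin m → Colour) → Fin #E ⊎ Fin m → Colour
  turnLabelled k ψ x = if carrierLabel x then turn k (ψ x) else ψ x

  -- Darts at a common vertex have the same label, so both are turned or neither is, and `turn k` is
  -- injective.
  turnLabelled-colouring : ∀ k {ψ} → IsTaitColouring M ψ → IsTaitColouring M (turnLabelled k ψ)
  turnLabelled-colouring k {ψ} tait = record { proper = proper′ ; free = free′ }
    where
    open IsTaitColouring tait

    cancel : ∀ {x y a b} → a ≡ b → (if a then turn k x else x) ≡ (if b then turn k y else y) → x ≡ y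
    cancel {a = true}  refl = turn-injective k
    cancel {a = false} refl = id

    proper′ : ∀ {v d d′} → Incident M d v → Incident M d′ v → d ≢ d′ →
              turnLabelled k ψ (carrier M d) ≢ turnLabelled k ψ (carrier M d′)
    proper′ {v} {d} {d′} d∈v d′∈v d≢d′ = proper d∈v d′∈v d≢d′
      ∘ cancel (trans (carrierLabel-incident d d∈v) (sym (carrierLabel-incident d′ d′∈v)))

    free′ : ∀ {i j} → attach i ≡ inj₂ j → turnLabelled k ψ (inj₂ i) ≡ turnLabelled k ψ (inj₂ j)
    free′ {i} eq = cong₂ (λ a x → if a then turn k x else x) (trans (labelling (semiedge i)) (cong c eq)) (free eq)

-- The turned colourings of `N` have states in `Col N`, hence in `Col T`. Colourings of `T` with
-- these states satisfy the hypotheses of `boundary-constant`, where `A` is the label of a semiedge.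
label-constant : ∀ {m} (T N : Multipole m) → ¬ Cycle (Multipole.graph T) → Connected T →
                 Satisfiable (Col N) → Col N ⊆ Col T →
                 (c : Node N → Bool) → ComponentLabelling N c → ∀ i j → c (inj₂ i) ≡ c (inj₂ j)
label-constant {m} T N acyclic connected (_ , ψ , tait , _) sub c labelling i j =
  constant (spread i j) (spread j i)
  where
  state : ∀ k → Col T (Vec.tabulate (turnLabelled N c labelling k ψ ∘ inj₂))
  state k = sub (_ , turnLabelled-colouring N c labelling k tait , refl)

  spread : ∀ i j → c (inj₂ i) ≡ true → c (inj₂ j) ≡ true
  spread = boundary-constant T acyclic connected (proj₁ ∘ state) (proj₁ ∘ proj₂ ∘ state) (c ∘ inj₂) (ψ ∘ inj₂)
    λ k i → trans (sym (lookup∘tabulate _ i))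
                  (trans (cong (λ v → Vec.lookup v i) (proj₂ (proj₂ (state k)))) (lookup∘tabulate _ i))

  constant : ∀ {a b} → (a ≡ true → b ≡ true) → (b ≡ true → a ≡ true) → a ≡ b
  constant {true}          f g = sym (f refl)
  constant {false} {true}  f g = g refl
  constant {false} {false} f g = refl

-- The component of `N` that holds all semiedges

module _ {m : ℕ} (N : Multipole m)
         (label-constant : (c : Node N → Bool) → ComponentLabelling N c → ∀ i j → c (inj₂ i) ≡ c (inj₂ j))
         (i₀ : Fin m) where
  open Multipole N

  walk⇒connected : ∀ {u v} → Walk graph u v → EqClosure (Adjacent N) (inj₁ u) (inj₁ v)
  walk⇒connected stop                           = Star.ε
  walk⇒connected (step e (inj₁ (refl , refl)) p) = fwd (edge e) ◅ walk⇒connected p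
  walk⇒connected (step e (inj₂ (refl , refl)) p) = bwd (edge e) ◅ walk⇒connected p

  connected-to : ∀ z → (∀ x → EqClosure (Adjacent N) x z) → Connected N
  connected-to z to-z x y = to-z x ◅◅ EqC.symmetric (Adjacent N) (to-z y)

  module _ {u} (attach-i₀ : attach i₀ ≡ inj₁ u) where

    private
      -- Indicator of the component of `u`: a semiedge takes the label of its vertex, and semiedges
      -- of free edges get `false`.
      c : Node N → Bool
      c (inj₁ v) = inComponent N u v
      c (inj₂ i) = onVertices (inComponent N u) (attach i)

      labelling : ComponentLabelling N c
      labelling (edge e) = inComponent-edge N u e
      labelling (semiedge i) with attach i in eq
      ... | inj₁ v = refl
      ... | inj₂ j = sym (cong (onVertices (inComponent N u)) (mate-sym eq))

      K = ℕSum.sum (λ v → 1 ℕSum.when inComponent N u v)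

    semiedges-in-component : ∀ i → c (inj₂ i) ≡ true
    semiedges-in-component i = trans (label-constant c labelling i i₀)
      (trans (cong (onVertices (inComponent N u)) attach-i₀) (dec-true (root graph (allFin #E) u ≟ _) refl))

    -- The component of `u` holds all `m` semiedges, hence has at least `m ∸ 2` vertices. If `N` has
    -- no more than that, the component is everything.
    vertex-case : m ≤ #V + 2 × (#V + 2 ≤ m → Connected N)
    vertex-case = ≤-trans m≤2+K (≤-trans (+-monoʳ-≤ 2 (sum-indicator≤n (inComponent N u))) (≤-reflexive (+-comm 2 #V)))
                , λ #V+2≤m → connected-to (inj₁ u) (to-u (full-sum (inComponent N u) (+-cancelˡ-≤ 2 #V K
                    (≤-trans (≤-reflexive (+-comm 2 #V)) (≤-trans #V+2≤m m≤2+K)))))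
      where
      m≤2+K : m ≤ 2 + K
      m≤2+K = semiedges≤component+2 N u semiedges-in-component

      to-u : (∀ v → inComponent N u v ≡ true) → ∀ x → EqClosure (Adjacent N) x (inj₁ u)
      to-u all-in (inj₁ v) = walk⇒connected (proj₁ (root-connected graph (allFin #E)
        (does-true (_ ≟ root graph (allFin #E) u) (all-in v))))
      -- Semiedges of free edges are labelled `false`, so only a semiedge at a vertex remains.
      to-u all-in (inj₂ i) with attach i in eq | semiedges-in-component i
      ... | inj₁ v | _ = fwd (subst (Adjacent N (inj₂ i)) eq (semiedge i)) ◅ to-u all-in (inj₁ v)

  module _ {j} (attach-i₀ : attach i₀ ≡ inj₂ j) where

    private
      OnFreeEdge : Node N → Set
      OnFreeEdge (inj₁ _) = ⊥
      OnFreeEdge (inj₂ k) = k ≡ i₀ ⊎ k ≡ j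

      onFreeEdge? : ∀ x → Dec (OnFreeEdge x)
      onFreeEdge? (inj₁ _) = no λ ()
      onFreeEdge? (inj₂ k) = (k ≟ i₀) ⊎-dec (k ≟ j)

      attached : ∀ k → OnFreeEdge (inj₂ k) → OnFreeEdge (attach k)
      attached _ (inj₁ refl) = subst OnFreeEdge (sym attach-i₀) (inj₂ refl)
      attached _ (inj₂ refl) = subst OnFreeEdge (sym (mate-sym attach-i₀)) (inj₁ refl)

      attaching : ∀ k → OnFreeEdge (attach k) → OnFreeEdge (inj₂ k)
      attaching k on with attach k in eq
      ... | inj₂ l = subst OnFreeEdge (mate-sym eq) (attached l on)

      labelling : ComponentLabelling N (does ∘ onFreeEdge?)
      labelling (edge e)     = refl
      labelling (semiedge k) = does-⇔ (mk⇔ (attached k) (attaching k)) (onFreeEdge? _) (onFreeEdge? _)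

    all-on-free-edge : ∀ k → k ≡ i₀ ⊎ k ≡ j
    all-on-free-edge k = does-true (onFreeEdge? (inj₂ k))
      (trans (label-constant _ labelling k i₀) (dec-true (onFreeEdge? (inj₂ i₀)) (inj₁ refl)))

    -- All semiedges lie on the free edge of `i₀` and `j`, so `m ≤ 2`; then `#V + 2 ≤ m` leaves no
    -- vertex, and `N` is that free edge.
    free-case : m ≤ #V + 2 × (#V + 2 ≤ m → Connected N)
    free-case = ≤-trans m≤2 (m≤n+m 2 #V)
              , λ #V+2≤m → connected-to (inj₂ i₀) (to-i₀ (n≤0⇒n≡0 (+-cancelʳ-≤ 2 #V 0 (≤-trans #V+2≤m m≤2))))
      where
      position : Fin m → Fin 2
      position k = if does (k ≟ i₀) then 0F else 1F

      position-injective : ∀ {k l} → position k ≡ position l → k ≡ l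
      position-injective {k} {l} eq with k ≟ i₀ | l ≟ i₀ | all-on-free-edge k | all-on-free-edge l
      ... | yes k≡i₀ | yes l≡i₀ | _ | _ = trans k≡i₀ (sym l≡i₀)
      ... | no k≢i₀  | no _     | inj₁ k≡i₀ | _ = contradiction k≡i₀ k≢i₀
      ... | no _     | no l≢i₀  | inj₂ _ | inj₁ l≡i₀ = contradiction l≡i₀ l≢i₀
      ... | no _     | no _     | inj₂ k≡j | inj₂ l≡j = trans k≡j (sym l≡j)

      m≤2 : m ≤ 2
      m≤2 = injective⇒≤ {f = position} position-injective

      to-i₀ : #V ≡ 0 → ∀ x → EqClosure (Adjacent N) x (inj₂ i₀)
      to-i₀ #V≡0 (inj₁ v) = contradiction (subst Fin #V≡0 v) ¬Fin0
      to-i₀ #V≡0 (inj₂ k) with all-on-free-edge k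
      ... | inj₁ refl = Star.ε
      ... | inj₂ refl = bwd (subst (Adjacent N (inj₂ i₀)) attach-i₀ (semiedge i₀)) ◅ Star.ε

  -- The first half yields irreducibility; the second, used when `N` has as many vertices as the
  -- tree, yields non-separability.
  component-bound : m ≤ #V + 2 × (#V + 2 ≤ m → Connected N)
  component-bound with attach i₀ in eq
  ... | inj₁ u = vertex-case eq
  ... | inj₂ j = free-case eq

-- Tree multipoles and the conclusion

tree-acyclic : ∀ {m} (T : Multipole m) → IsTreeMultipole T → ¬ Cycle (Multipole.graph T)
tree-acyclic T (_ , inj₁ (_ , _ , acyclic)) = acyclic
tree-acyclic T (_ , inj₂ (_ , #V≡0)) cycle  = ¬Fin0 (subst Fin #V≡0 (Cycle.base cycle))

-- Equality of nodes in `connectivity` is lying in one component, so injectivity into `Fin 1` is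
-- connectedness.
tree-connected : ∀ {m} (T : Multipole m) → IsTreeMultipole T → Connected T
tree-connected T (one , _) x y = Bijection.injective one (only _ _)
  where
  only : (i j : Fin 1) → i ≡ j
  only 0F 0F = refl

tree-bound : ∀ {m} (T : Multipole m) → IsTreeMultipole T → Multipole.#V T + 2 ≤ m
tree-bound T (_ , inj₁ (0<#V , _ , acyclic)) = acyclic⇒#V+2≤m T (fromℕ< 0<#V) acyclic
tree-bound T (_ , inj₂ (refl , #V≡0))        = ≤-reflexive (cong (_+ 2) #V≡0)

connected⇒components≤1 : ∀ {m} (M : Multipole m) {c} → Connected M → HasComponents M c → c ≤ 1
connected⇒components≤1 M {0}           _         _     = z≤n
connected⇒components≤1 M {1}           _         _     = s≤s z≤n
connected⇒components≤1 M {suc (suc c)} connected count with surjective 0F | surjective 1F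
  where open Bijection count
... | x , x↦0 | y , y↦1 with trans (sym (x↦0 Star.ε)) (trans (Bijection.cong count (connected x y)) (y↦1 Star.ε))
... | ()

proposition6p1 : (m : ℕ) → 2 ≤ m → (T : Multipole m) → IsTreeMultipole T → NonSeparable T × Irreducible T
proposition6p1 (suc m) _ T tree = nonSeparable , irreducible
  where
  open Multipole using (#V)

  bound : ∀ N → Satisfiable (Col N) → Col N ⊆ Col T →
          suc m ≤ #V N + 2 × (#V N + 2 ≤ suc m → Connected N)
  bound N sat sub = component-bound N
    (label-constant T N (tree-acyclic T tree) (tree-connected T tree) sat sub) 0F

  irreducible : Irreducible T
  irreducible (N , N<T , sat , sub) =
    -- With `m` the total number of semiedges: `#V N + 2 < #V T + 2 ≤ m ≤ #V N + 2`.
    <-irrefl refl (<-≤-trans (+-monoˡ-< 2 N<T) (≤-trans (tree-bound T tree) (proj₁ (bound N sat sub))))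

  nonSeparable : NonSeparable T
  nonSeparable (N , c , c′ , T-has-c , N-has-c′ , c<c′ , #V≡ , sat , sub)
    with ≤-trans c<c′ (connected⇒components≤1 N connected N-has-c′)
    where
    connected : Connected N
    connected = proj₂ (bound N sat sub) (subst (λ k → k + 2 ≤ suc m) (sym #V≡) (tree-bound T tree))
  -- From `c < c′ ≤ 1` follows `c ≡ 0`, but `T` has a semiedge, whose component would be an element
  -- of `Fin 0`.
  ... | s≤s z≤n = ¬Fin0 (Bijection.to T-has-c (inj₂ 0F))
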